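{- Let $p$ and $q$ be distinct primes, $n=pq$, and let $e$ be a positive integer with $\gcd(e,\varphi(n))=1$. For a positive integer $k$, let $E_{n,e,k}$ be the set of residues $m\in\mathbb{Z}_n$ such that $k$ is the smallest positive integer with $m^{e^{k}}\equiv m \pmod n$ (the fixed points of order $k$ of the map $x\mapsto x^{e}\bmod n$). Then $$|E_{n,e,k}|=\sum_{d\mid k}\mu(k/d)\,\bigl(\gcd(e^{d}-1,p-1)+1\bigr)\bigl(\gcd(e^{d}-1,q-1)+1\bigr),$$ where the sum runs over the positive divisors $d$ of $k$ and $\mu$ is the Möbius function.
   Context: $\mathbb{Z}_n$ denotes a complete residue system modulo $n$, $\varphi$ is Euler's totient function, and $\gcd(a,b)$ is the greatest common divisor (with $\gcd(0,b)=b$). -}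

module Defs where

open import Data.Bool.Base using (if_then_else_)
open import Data.Fin.Base using (Fin; toℕ)
open import Data.Fin.Subset using (Subset)
open import Data.Integer.Base as ℤ using (ℤ; 0ℤ; 1ℤ; -1ℤ)
open import Data.Integer.Properties using (+-0-commutativeMonoid)
open import Data.List.Base using (List; applyUpTo; filter; length)
open import Data.List.Relation.Unary.Any using (any?)
open import Data.Nat.Base using (ℕ; suc; _*_; _^_; _<_; _≤_; NonZero; ∣_-_∣)
open import Data.Nat.Coprimality using (coprime?)
open import Data.Nat.Divisibility using (_∣_; _∣?_)
open import Data.Nat.Primality using (prime?)
open import Data.Nat.Properties using (_<?_; allUpTo?; ≮⇒≥; <⇒≱)
open import Data.Product.Base using (_,_)
open import Data.Vec.Base using (tabulate)
open import Relation.Nullary.Decidable using (Dec; does; map′; ¬?; _×-dec_; _→-dec_)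
open import Relation.Unary using (Pred; Decidable)
open import Level using (0ℓ)

open import Algebra.Properties.CommutativeMonoid.Sum +-0-commutativeMonoid
  using (sum-syntax)

oneUpTo : ℕ → List ℕ
oneUpTo n = applyUpTo suc n

φ : ℕ → ℕ
φ n = length (filter (λ a → coprime? a n) (oneUpTo n))

primeDivisors : ℕ → List ℕ
primeDivisors n = filter prime? (filter (_∣? n) (oneUpTo n))

-- Meaningful for positive arguments only; μ 0 takes the junk value 1.
μ : ℕ → ℤ
μ n = if does (any? (λ r → r * r ∣? n) (primeDivisors n))
      then 0ℤ
      else -1ℤ ℤ.^ length (primeDivisors n)

-- Every divisor of a positive k is of the form suc i with i < k.  The summand
-- only has to be defined at nonzero d, so that it may divide by d.
divisorSum : (k : ℕ) → ((d : ℕ) .{{_ : NonZero d}} → ℤ) → ℤ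
divisorSum k f =
  ∑[ i < k ] (if does (suc (toℕ i) ∣? k) then f (suc (toℕ i)) else 0ℤ)

infix 4 _≡_[mod_]

_≡_[mod_] : ℕ → ℕ → ℕ → Set
a ≡ b [mod n ] = n ∣ ∣ a - b ∣

record IsSmallestPositive (P : Pred ℕ 0ℓ) (k : ℕ) : Set where
  field
    positive : 0 < k
    holds    : P k
    minimal  : ∀ j → 0 < j → P j → k ≤ j

isSmallestPositive? : {P : Pred ℕ 0ℓ} → Decidable P → Decidable (IsSmallestPositive P)
isSmallestPositive? P? k = map′
  (λ (k>0 , Pk , below) → record
    { positive = k>0
    ; holds    = Pk
    ; minimal  = λ j j>0 Pj → ≮⇒≥ (λ j<k → below j<k j>0 Pj)
    })
  (λ s → let open IsSmallestPositive s in
    positive , holds , λ {j} j<k j>0 Pj → <⇒≱ j<k (minimal j j>0 Pj))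
  (0 <? k ×-dec P? k ×-dec
    allUpTo? (λ j → (0 <? j) →-dec ¬? (P? j)) k)

IsFixedPointOfOrder : (n e k : ℕ) → Fin n → Set
IsFixedPointOfOrder n e k m =
  IsSmallestPositive (λ j → toℕ m ^ (e ^ j) ≡ toℕ m [mod n ]) k

isFixedPointOfOrder? : ∀ n e k → Decidable (IsFixedPointOfOrder n e k)
isFixedPointOfOrder? n e k m =
  isSmallestPositive? (λ j → n ∣? ∣ toℕ m ^ (e ^ j) - toℕ m ∣) k

-- The residues modulo n are represented by Fin n, i.e. by 0, …, n − 1.
E : (n e k : ℕ) → Subset n
E n e k = tabulate (λ m → does (isFixedPointOfOrder? n e k m))

{-# OPTIONS --safe #-}

-- The order of m under x ↦ x^e divides d exactly when m^(e^d) ≡ m, so the theorem is Möbius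
-- inversion of the count of solutions of x^s ≡ x (mod pq) for s = e^d.  By the Chinese remainder
-- theorem that count is multiplicative.  Modulo a prime p, Fermat and Bézout replace s − 1 by
-- g = gcd (s − 1, p − 1); then x^(g+1) − x divides x^p − x, which vanishes everywhere, so by
-- Lagrange's bound on the roots of both factors it has exactly g + 1 roots.

module Submission where

open import Defs
open import Data.Bool.Base using (if_then_else_; true; false)
open import Data.Fin.Base using (Fin; zero; suc; toℕ; fromℕ; inject₁)
open import Data.Fin.Properties using (toℕ<n; toℕ-fromℕ; toℕ-inject₁)
open import Data.Fin.Subset using (∣_∣)
open import Data.Integer.Base as ℤ using (ℤ; +_; 0ℤ; 1ℤ; -1ℤ)
import Data.Integer.Divisibility.Signed as ℤ
import Data.Integer.Properties as ℤ
import Data.Integer.Tactic.RingSolver as ℤ-Solver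
open import Data.List.Base
  using (List; []; _∷_; map; filter; length; applyUpTo; upTo; cartesianProduct)
open import Data.List.Membership.Propositional using (_∈_; lose; find)
open import Data.List.Membership.Propositional.Properties
  using ( ∈-map⁺; ∈-map⁻; ∈-filter⁺; ∈-filter⁻; ∈-applyUpTo⁺; ∈-upTo⁺; ∈-upTo⁻
        ; ∈-cartesianProduct⁺; ∈-cartesianProduct⁻)
open import Data.List.Membership.Propositional.Properties.WithK using (unique∧set⇒bag)
open import Data.List.Properties using (length-map; length-++; filter-≐; length-applyUpTo)
open import Data.List.Relation.Binary.BagAndSetEquality using (∼bag⇒↭)
open import Data.List.Relation.Binary.Permutation.Propositional
  using (_↭_; refl; prep; swap; trans)
open import Data.List.Relation.Binary.Permutation.Propositional.Properties using (↭-length)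
open import Data.List.Relation.Unary.All as All using (All; []; _∷_)
import Data.List.Relation.Unary.All.Properties as All
open import Data.List.Relation.Unary.AllPairs using (AllPairs; []; _∷_)
import Data.List.Relation.Unary.AllPairs.Properties as AllPairs
open import Data.List.Relation.Unary.Any using (any?; here; there)
open import Data.List.Relation.Unary.Unique.Propositional using (Unique)
import Data.List.Relation.Unary.Unique.Propositional.Properties as Unique
open import Data.Nat.Base
open import Data.Nat.Combinatorics using (_C_; nCn≡1; nCk≡n!/k![n-k]!; k![n∸k]!∣n!)
open import Data.Nat.Coprimality as Coprimality using (Coprime; coprime-divisor; coprime-Bézout)
open import Data.Nat.DivMod
open import Data.Nat.Divisibility
open import Data.Nat.GCD using (gcd; gcd-GCD; gcd[m,n]∣m; gcd[m,n]∣n; module Bézout)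
open import Data.Nat.Induction using (<-rec)
open import Data.Nat.Primality
open import Data.Nat.Primality.Factorisation using (factorise)
open import Data.Nat.Properties
import Data.Nat.Tactic.RingSolver as ℕ-Solver
open import Data.Product.Base using (∃; _×_; _,_; proj₁; proj₂)
open import Data.Sum.Base using (_⊎_; inj₁; inj₂; [_,_]′)
open import Data.Vec.Base using (Vec; []; _∷_; _++_; replicate; tabulate)
open import Function.Base using (_∘_; id)
open import Function.Bundles using (mk⇔)
open import Level using (0ℓ)
open import Relation.Binary.PropositionalEquality as ≡
  using (_≡_; _≢_; refl; sym; cong; cong₂; subst; module ≡-Reasoning)
open import Relation.Nullary using (¬_; Dec; yes; no; does; contradiction)
open import Relation.Nullary.Decidable
  using (toSum; dec-true; dec-false; does-⇔; ¬?; _×-dec_)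
open import Relation.Unary using (Pred; Decidable)

open ≡-Reasoning

-- Finite sums over lists

-- The inversion happens at each point, before anything is counted. For a fixed x, the sum of μ(k/d)
-- over the divisors d of k with x^(e^d) ≡ x is 1 if x has order k and 0 otherwise. Summing over x
-- and exchanging the two sums leaves, for each d, a count of solutions of x^s ≡ x. A point that is
-- not periodic simply contributes 0. Modulo a prime, x = 0 is always a solution, so the equation
-- cannot be divided by x. Every congruence therefore keeps the shape x^(a+1) ≡ x, with one spare
-- factor x on both sides; the solution 0 is what the `+ 1` beside each gcd counts.

exchange : ∀ a b c → a ℤ.+ (b ℤ.+ c) ≡ b ℤ.+ (a ℤ.+ c)
exchange = ℤ-Solver.solve-∀

module _ {A : Set} where

  ∑ : List A → (A → ℤ) → ℤ
  ∑ []       f = 0ℤ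
  ∑ (x ∷ xs) f = f x ℤ.+ ∑ xs f

  ∑-cong : ∀ {f g : A → ℤ} xs → (∀ {x} → x ∈ xs → f x ≡ g x) → ∑ xs f ≡ ∑ xs g
  ∑-cong []       f≗g = refl
  ∑-cong (x ∷ xs) f≗g = cong₂ ℤ._+_ (f≗g (here refl)) (∑-cong xs (f≗g ∘ there))

  ∑-zero : ∀ {f : A → ℤ} xs → (∀ {x} → x ∈ xs → f x ≡ 0ℤ) → ∑ xs f ≡ 0ℤ
  ∑-zero []       f≗0 = refl
  ∑-zero (x ∷ xs) f≗0 = cong₂ ℤ._+_ (f≗0 (here refl)) (∑-zero xs (f≗0 ∘ there))

  ∑-+ : ∀ (f g : A → ℤ) xs → ∑ xs (λ x → f x ℤ.+ g x) ≡ ∑ xs f ℤ.+ ∑ xs g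
  ∑-+ f g []       = refl
  ∑-+ f g (x ∷ xs) = ≡.trans (cong (ℤ._+_ (f x ℤ.+ g x)) (∑-+ f g xs)) (interchange (f x) (g x) _ _)
    where
    interchange : ∀ a b c d → (a ℤ.+ b) ℤ.+ (c ℤ.+ d) ≡ (a ℤ.+ c) ℤ.+ (b ℤ.+ d)
    interchange = ℤ-Solver.solve-∀

  ∑-*ˡ : ∀ c (f : A → ℤ) xs → ∑ xs (λ x → c ℤ.* f x) ≡ c ℤ.* ∑ xs f
  ∑-*ˡ c f []       = sym (ℤ.*-zeroʳ c)
  ∑-*ˡ c f (x ∷ xs) =
    ≡.trans (cong (ℤ._+_ (c ℤ.* f x)) (∑-*ˡ c f xs)) (sym (ℤ.*-distribˡ-+ c (f x) (∑ xs f)))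

  ∑-neg : ∀ (f : A → ℤ) xs → ∑ xs (λ x → ℤ.- f x) ≡ ℤ.- ∑ xs f
  ∑-neg f []       = refl
  ∑-neg f (x ∷ xs) =
    ≡.trans (cong (ℤ._+_ (ℤ.- f x)) (∑-neg f xs)) (sym (ℤ.neg-distrib-+ (f x) (∑ xs f)))

  ∑-↭ : ∀ {f : A → ℤ} {xs ys} → xs ↭ ys → ∑ xs f ≡ ∑ ys f
  ∑-↭ refl                 = refl
  ∑-↭ {f} (prep x r)       = cong (ℤ._+_ (f x)) (∑-↭ r)
  ∑-↭ {f} (swap x y r) =
    ≡.trans (exchange (f x) (f y) _) (cong (λ s → f y ℤ.+ (f x ℤ.+ s)) (∑-↭ r))
  ∑-↭ (trans r s)          = ≡.trans (∑-↭ r) (∑-↭ s)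

  module _ {P : Pred A 0ℓ} (P? : Decidable P) where

    ∑-filter-split : ∀ (f : A → ℤ) xs →
      ∑ xs f ≡ ∑ (filter P? xs) f ℤ.+ ∑ (filter (¬? ∘ P?) xs) f
    ∑-filter-split f []       = refl
    ∑-filter-split f (x ∷ xs) with does (P? x)
    ... | true  = ≡.trans (cong (ℤ._+_ (f x)) (∑-filter-split f xs)) (sym (ℤ.+-assoc (f x) _ _))
    ... | false = ≡.trans (cong (ℤ._+_ (f x)) (∑-filter-split f xs)) (exchange (f x) (∑ (filter P? xs) f) _)

∑-swap : ∀ {A B : Set} (f : A → B → ℤ) xs ys →
  ∑ xs (λ x → ∑ ys (f x)) ≡ ∑ ys (λ y → ∑ xs (λ x → f x y))
∑-swap f []       ys = sym (∑-zero ys (λ _ → refl))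
∑-swap f (x ∷ xs) ys =
  ≡.trans (cong (ℤ._+_ (∑ ys (f x))) (∑-swap f xs ys)) (sym (∑-+ (f x) _ ys))

∑-map : ∀ {A B : Set} (h : A → B) (f : B → ℤ) xs → ∑ (map h xs) f ≡ ∑ xs (f ∘ h)
∑-map h f []       = refl
∑-map h f (x ∷ xs) = cong (ℤ._+_ (f (h x))) (∑-map h f xs)

-- Indicators of decidable propositions

⟦_⟧ : ∀ {P : Set} → Dec P → ℤ
⟦ P? ⟧ = if does P? then 1ℤ else 0ℤ

⟦⟧-⇔ : ∀ {P Q : Set} (P? : Dec P) (Q? : Dec Q) → (P → Q) → (Q → P) → ⟦ P? ⟧ ≡ ⟦ Q? ⟧
⟦⟧-⇔ P? Q? f g = cong (if_then 1ℤ else 0ℤ) (does-⇔ (mk⇔ f g) P? Q?)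

module _ {A : Set} {P : Pred A 0ℓ} (P? : Decidable P) where

  ∑-filter : ∀ (f : A → ℤ) xs → ∑ (filter P? xs) f ≡ ∑ xs (λ x → ⟦ P? x ⟧ ℤ.* f x)
  ∑-filter f []       = refl
  ∑-filter f (x ∷ xs) with does (P? x)
  ... | true  = cong₂ ℤ._+_ (sym (ℤ.*-identityˡ (f x))) (∑-filter f xs)
  ... | false = ≡.trans (∑-filter f xs) (sym (ℤ.+-identityˡ _))

  length-filter-∑ : ∀ xs → + length (filter P? xs) ≡ ∑ xs (λ x → ⟦ P? x ⟧)
  length-filter-∑ []       = refl
  length-filter-∑ (x ∷ xs) with does (P? x)
  ... | true  = cong (ℤ._+_ 1ℤ) (length-filter-∑ xs)
  ... | false = ≡.trans (length-filter-∑ xs) (sym (ℤ.+-identityˡ _))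

-- Bijections as permutations of duplicate-free lists

module _ {A B : Set} {h : A → B} where

  map-unique : ∀ {xs} → (∀ {x y} → x ∈ xs → y ∈ xs → h x ≡ h y → x ≡ y) →
    Unique xs → Unique (map h xs)
  map-unique inj []         = []
  map-unique inj (x≢ ∷ xs!) =
    All.map⁺ (All.tabulate (λ y∈ hx≡hy → All.lookup x≢ y∈ (inj (here refl) (there y∈) hx≡hy)))
    ∷ map-unique (λ x∈ y∈ → inj (there x∈) (there y∈)) xs!

  -- Duplicate-free lists with the same members are permutations of each other. Injectivity is asked
  -- only on `xs`, because `k ÷_` and the pair of residues modulo `m` and `n` are not injective on
  -- all of ℕ.
  map-↭ : ∀ {xs ys} → Unique xs → Unique ys →
    (∀ {x y} → x ∈ xs → y ∈ xs → h x ≡ h y → x ≡ y) →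
    (∀ {x} → x ∈ xs → h x ∈ ys) →
    (∀ {y} → y ∈ ys → ∃ λ x → x ∈ xs × y ≡ h x) →
    map h xs ↭ ys
  map-↭ {xs} {ys} xs! ys! inj into onto =
    ∼bag⇒↭ (unique∧set⇒bag (map-unique inj xs!) ys! (mk⇔ to from))
    where
    to : ∀ {y} → y ∈ map h xs → y ∈ ys
    to y∈ with x , x∈ , refl ← ∈-map⁻ h y∈ = into x∈
    from : ∀ {y} → y ∈ ys → y ∈ map h xs
    from y∈ with x , x∈ , refl ← onto y∈ = ∈-map⁺ h x∈

unique-↭ : ∀ {A : Set} {xs ys : List A} → Unique xs → Unique ys →
  (∀ {x} → x ∈ xs → x ∈ ys) → (∀ {x} → x ∈ ys → x ∈ xs) → xs ↭ ys
unique-↭ xs! ys! to from = ∼bag⇒↭ (unique∧set⇒bag xs! ys! (mk⇔ to from))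

-- Divisors and the Möbius function

divisors : ℕ → List ℕ
divisors n = filter (_∣? n) (oneUpTo n)

oneUpTo-unique : ∀ n → Unique (oneUpTo n)
oneUpTo-unique n = Unique.applyUpTo⁺₁ suc n (λ i<j _ → <⇒≢ (s<s i<j))

divisors-unique : ∀ n → Unique (divisors n)
divisors-unique n = Unique.filter⁺ (_∣? n) (oneUpTo-unique n)

∣⇒>0 : ∀ {d n} → 0 < n → d ∣ n → 0 < d
∣⇒>0 {zero}  n>0 0∣n = contradiction (0∣⇒≡0 0∣n) (>⇒≢ n>0)
∣⇒>0 {suc d} n>0 _   = z<s

∈-divisors⁺ : ∀ {d n} → 0 < n → d ∣ n → d ∈ divisors n
∈-divisors⁺ {zero}  n>0 0∣n = contradiction (0∣⇒≡0 0∣n) (>⇒≢ n>0)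
∈-divisors⁺ {suc d} {n} n>0 d∣n = ∈-filter⁺ (_∣? n) (∈-applyUpTo⁺ suc (∣⇒≤ {{>-nonZero n>0}} d∣n)) d∣n

∈-divisors⁻ : ∀ {d n} → d ∈ divisors n → d ∣ n
∈-divisors⁻ {n = n} d∈ = proj₂ (∈-filter⁻ (_∣? n) {xs = oneUpTo n} d∈)

∈-primeDivisors⁺ : ∀ {r n} → 0 < n → Prime r → r ∣ n → r ∈ primeDivisors n
∈-primeDivisors⁺ n>0 r-prime r∣n = ∈-filter⁺ prime? (∈-divisors⁺ n>0 r∣n) r-prime

∈-primeDivisors⁻ : ∀ {r n} → r ∈ primeDivisors n → Prime r × (r ∣ n)
∈-primeDivisors⁻ {n = n} r∈ with r∈divs , r-prime ← ∈-filter⁻ prime? {xs = divisors n} r∈ =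
  r-prime , ∈-divisors⁻ r∈divs

prime>0 : ∀ {p} → Prime p → 0 < p
prime>0 p-prime = >-nonZero⁻¹ _ {{prime⇒nonZero p-prime}}

prime∣prime : ∀ {p q} → Prime p → Prime q → p ∣ q → p ≡ q
prime∣prime p-prime q-prime p∣q with prime⇒irreducible q-prime p∣q
... | inj₁ refl = contradiction p-prime ¬prime[1]
... | inj₂ p≡q  = p≡q

primes-coprime : ∀ {p q} → Prime p → Prime q → p ≢ q → Coprime p q
primes-coprime p-prime q-prime p≢q {d} (d∣p , d∣q) with prime⇒irreducible p-prime d∣p
... | inj₁ d≡1  = d≡1
... | inj₂ refl = contradiction (prime∣prime p-prime q-prime d∣q) p≢q

coprime-*-∣ : ∀ {m n o} → Coprime m n → m ∣ o → n ∣ o → m * n ∣ o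
coprime-*-∣ {m} {n} c m∣o (divides t refl) =
  *-monoˡ-∣ n (coprime-divisor c (subst (m ∣_) (*-comm t n) m∣o))

∤⇒coprime : ∀ {p n} → Prime p → ¬ p ∣ n → Coprime p n
∤⇒coprime p-prime p∤n (d∣p , d∣n) with prime⇒irreducible p-prime d∣p
... | inj₁ d≡1  = d≡1
... | inj₂ refl = contradiction d∣n p∤n

squareful? : ∀ n → Dec _
squareful? n = any? (λ r → r * r ∣? n) (primeDivisors n)

μ-square : ∀ {p n} → 0 < n → Prime p → p * p ∣ n → μ n ≡ 0ℤ
μ-square {p} {n} n>0 p-prime p²∣n
  rewrite dec-true (squareful? n)
    (lose (∈-primeDivisors⁺ n>0 p-prime (∣-trans (m∣m*n p) p²∣n)) p²∣n) = refl

module _ {p n} (n>0 : 0 < n) (p-prime : Prime p) (p∤n : ¬ p ∣ n) where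

  private
    pn>0 : 0 < p * n
    pn>0 = *-mono-< (prime>0 p-prime) n>0

  primeDivisors-* : primeDivisors (p * n) ↭ p ∷ primeDivisors n
  primeDivisors-* = unique-↭
    (Unique.filter⁺ prime? (divisors-unique (p * n)))
    (All.tabulate (λ r∈ → λ { refl → p∤n (proj₂ (∈-primeDivisors⁻ r∈)) })
      ∷ Unique.filter⁺ prime? (divisors-unique n))
    to from
    where
    to : ∀ {r} → r ∈ primeDivisors (p * n) → r ∈ p ∷ primeDivisors n
    to r∈ with r-prime , r∣pn ← ∈-primeDivisors⁻ {n = p * n} r∈
      with euclidsLemma p n r-prime r∣pn
    ... | inj₁ r∣p = here (prime∣prime r-prime p-prime r∣p)
    ... | inj₂ r∣n = there (∈-primeDivisors⁺ n>0 r-prime r∣n)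
    from : ∀ {r} → r ∈ p ∷ primeDivisors n → r ∈ primeDivisors (p * n)
    from (here refl) = ∈-primeDivisors⁺ pn>0 p-prime (m∣m*n n)
    from (there r∈) with r-prime , r∣n ← ∈-primeDivisors⁻ r∈ =
      ∈-primeDivisors⁺ pn>0 r-prime (∣n⇒∣m*n p r∣n)

  -- Since `p` divides `p * n` exactly once, a prime whose square divides `p * n` differs from `p`,
  -- and its square already divides `n`.
  squareful-* : does (squareful? (p * n)) ≡ does (squareful? n)
  squareful-* = does-⇔ (mk⇔ to from) (squareful? (p * n)) (squareful? n)
    where
    to : _ → _
    to any with r , r∈ , r²∣pn ← find any
      with r-prime , _ ← ∈-primeDivisors⁻ {n = p * n} r∈
      with r ≟ p
    ... | yes refl = contradiction (*-cancelˡ-∣ p {{prime⇒nonZero p-prime}} r²∣pn) p∤n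
    ... | no r≢p   = lose (∈-primeDivisors⁺ n>0 r-prime (∣-trans (m∣m*n r) r²∣n)) r²∣n
      where
      r-coprime-p : Coprime r p
      r-coprime-p = primes-coprime r-prime p-prime r≢p
      -- Coprimality to `p` is known for `r`, not for `r * r`, so the two factors `r` are moved past
      -- `p` one at a time.
      r²∣n : r * r ∣ n
      r²∣n with divides t n≡tr ← coprime-divisor r-coprime-p (∣-trans (m∣m*n r) r²∣pn) =
        subst (r * r ∣_) (sym n≡tr)
          (*-monoˡ-∣ r (coprime-divisor r-coprime-p
            (*-cancelʳ-∣ r {{prime⇒nonZero r-prime}}
              (subst (r * r ∣_) (≡.trans (cong (p *_) n≡tr) (sym (*-assoc p t r))) r²∣pn))))
    from : _ → _
    from any with r , r∈ , r²∣n ← find any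
      with r-prime , r∣n ← ∈-primeDivisors⁻ {n = n} r∈ =
      lose (∈-primeDivisors⁺ pn>0 r-prime (∣n⇒∣m*n p r∣n)) (∣n⇒∣m*n p r²∣n)

  μ-prime-* : μ (p * n) ≡ ℤ.- μ n
  μ-prime-* rewrite squareful-* | ↭-length primeDivisors-* with does (squareful? n)
  ... | true  = refl
  ... | false = ℤ.-1*i≡-i (-1ℤ ℤ.^ length (primeDivisors n))

prime-divisor : ∀ n → 1 < n → ∃ λ p → Prime p × (p ∣ n)
prime-divisor n n>1 with factorise n {{>-nonZero (<-trans z<s n>1)}}
... | record { factors = [] ; isFactorisation = refl } = contradiction n>1 (n≮n 1)
... | record { factors = p ∷ ps ; isFactorisation = refl ; factorsPrime = p-prime ∷ _ } =
  p , p-prime , m∣m*n _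

-- The squarefree divisors of n pair off as d, p d for a prime p dividing n, with opposite signs.
∑-μ-divisors : ∀ n → 0 < n → ∑ (divisors n) μ ≡ ⟦ n ≟ 1 ⟧
∑-μ-divisors n n>0 with n ≟ 1
... | yes refl = refl
... | no n≢1 with p , p-prime , p∣n ← prime-divisor n (≤∧≢⇒< n>0 (n≢1 ∘ sym)) = begin
  ∑ ds μ                                        ≡⟨ ∑-filter-split (p ∣?_) μ ds ⟩
  ∑ pds μ ℤ.+ ∑ p′ds μ                          ≡⟨ cong (ℤ._+ ∑ p′ds μ) (∑-filter-split (p * p ∣?_) μ pds) ⟩
  ∑ (filter (p * p ∣?_) pds) μ ℤ.+ ∑ sds μ ℤ.+ ∑ p′ds μ
    ≡⟨ cong (λ s → s ℤ.+ ∑ sds μ ℤ.+ ∑ p′ds μ) (∑-zero (filter (p * p ∣?_) pds) square) ⟩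
  0ℤ ℤ.+ ∑ sds μ ℤ.+ ∑ p′ds μ                   ≡⟨ cong (ℤ._+ ∑ p′ds μ) (ℤ.+-identityˡ (∑ sds μ)) ⟩
  ∑ sds μ ℤ.+ ∑ p′ds μ                          ≡⟨ cong (ℤ._+ ∑ p′ds μ) (∑-↭ pairing) ⟨
  ∑ (map (p *_) p′ds) μ ℤ.+ ∑ p′ds μ            ≡⟨ cong (ℤ._+ ∑ p′ds μ) (∑-map (p *_) μ p′ds) ⟩
  ∑ p′ds (λ d → μ (p * d)) ℤ.+ ∑ p′ds μ         ≡⟨ cong (ℤ._+ ∑ p′ds μ) (∑-cong p′ds flip-sign) ⟩
  ∑ p′ds (λ d → ℤ.- μ d) ℤ.+ ∑ p′ds μ           ≡⟨ cong (ℤ._+ ∑ p′ds μ) (∑-neg μ p′ds) ⟩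
  ℤ.- ∑ p′ds μ ℤ.+ ∑ p′ds μ                     ≡⟨ ℤ.+-inverseˡ (∑ p′ds μ) ⟩
  0ℤ                                            ≡⟨ cong (if_then 1ℤ else 0ℤ) (dec-false (n ≟ 1) n≢1) ⟨
  ⟦ n ≟ 1 ⟧                                     ∎
  where
  -- `p′ds` holds the divisors prime to `p`, and `sds` those containing `p` exactly once;
  -- multiplication by `p` maps the former onto the latter. Divisors containing `p` at least twice
  -- contribute 0.
  ds pds p′ds sds : List ℕ
  ds   = divisors n
  pds  = filter (p ∣?_) ds
  p′ds = filter (¬? ∘ (p ∣?_)) ds
  sds  = filter (¬? ∘ (p * p ∣?_)) pds

  instance
    p≢0 : NonZero p
    p≢0 = prime⇒nonZero p-prime

  ∈-pds : ∀ {d} → d ∈ pds → (d ∣ n) × (p ∣ d)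
  ∈-pds d∈ with d∈ds , p∣d ← ∈-filter⁻ (p ∣?_) {xs = ds} d∈ = ∈-divisors⁻ d∈ds , p∣d

  ∈-p′ds : ∀ {d} → d ∈ p′ds → (d ∣ n) × (¬ p ∣ d)
  ∈-p′ds d∈ with d∈ds , p∤d ← ∈-filter⁻ (¬? ∘ (p ∣?_)) {xs = ds} d∈ = ∈-divisors⁻ d∈ds , p∤d

  square : ∀ {d} → d ∈ filter (p * p ∣?_) pds → μ d ≡ 0ℤ
  square d∈ with d∈pds , p²∣d ← ∈-filter⁻ (p * p ∣?_) {xs = pds} d∈ =
    μ-square (∣⇒>0 n>0 (proj₁ (∈-pds d∈pds))) p-prime p²∣d

  flip-sign : ∀ {d} → d ∈ p′ds → μ (p * d) ≡ ℤ.- μ d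
  flip-sign d∈ with d∣n , p∤d ← ∈-p′ds d∈ = μ-prime-* (∣⇒>0 n>0 d∣n) p-prime p∤d

  pairing : map (p *_) p′ds ↭ sds
  pairing = map-↭
    (Unique.filter⁺ (¬? ∘ (p ∣?_)) (divisors-unique n))
    (Unique.filter⁺ (¬? ∘ (p * p ∣?_)) (Unique.filter⁺ (p ∣?_) (divisors-unique n)))
    (λ _ _ → *-cancelˡ-≡ _ _ p)
    into onto
    where
    into : ∀ {d} → d ∈ p′ds → p * d ∈ sds
    into {d} d∈ with d∣n , p∤d ← ∈-p′ds d∈ =
      ∈-filter⁺ (¬? ∘ (p * p ∣?_))
        (∈-filter⁺ (p ∣?_)
          (∈-divisors⁺ n>0 (coprime-*-∣ (∤⇒coprime p-prime p∤d) p∣n d∣n))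
          (m∣m*n d))
        (p∤d ∘ *-cancelˡ-∣ p)
    onto : ∀ {d} → d ∈ sds → ∃ λ c → c ∈ p′ds × d ≡ p * c
    onto d∈ with d∈pds , p²∤d ← ∈-filter⁻ (¬? ∘ (p * p ∣?_)) {xs = pds} d∈
      with d∣n , divides c refl ← ∈-pds d∈pds =
      c
      , ∈-filter⁺ (¬? ∘ (p ∣?_)) (∈-divisors⁺ n>0 (∣-trans (m∣m*n p) d∣n))
          (p²∤d ∘ *-monoˡ-∣ p)
      , *-comm c p

-- Quotients, divisor sums and subset sizes in terms of lists

infixl 7 _÷_

-- A quotient total in `d`, for summands ranging over a list, where no instance `NonZero d` is at
-- hand. The value at zero is never reached, as `divisors` lists positive numbers only; at a
-- successor it is `/` by definition.
_÷_ : ℕ → ℕ → ℕ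
k ÷ zero  = 0
k ÷ suc d = k / suc d

÷-* : ∀ {d k} → 0 < d → d ∣ k → (k ÷ d) * d ≡ k
÷-* {suc d} _ d∣k = m/n*n≡m d∣k

*-÷ : ∀ {d} c → 0 < d → c * d ÷ d ≡ c
*-÷ {suc d} c _ = m*n/n≡m c (suc d)

divisorSum-∑ : ∀ k (f : ℕ → ℤ) → divisorSum k (λ d → f d) ≡ ∑ (divisors k) f
divisorSum-∑ k f = go k suc
  where
  open import Algebra.Properties.CommutativeMonoid.Sum ℤ.+-0-commutativeMonoid using (sum)
  -- Generalised from `suc` to any `h`, because both sums pass `h ∘ suc` on to their tails.
  go : ∀ n (h : ℕ → ℕ) →
    sum {n} (λ i → if does (h (toℕ i) ∣? k) then f (h (toℕ i)) else 0ℤ) ≡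
    ∑ (filter (_∣? k) (applyUpTo h n)) f
  go zero    h = refl
  go (suc n) h with does (h 0 ∣? k)
  ... | true  = cong (ℤ._+_ (f (h 0))) (go n (h ∘ suc))
  ... | false = ≡.trans (ℤ.+-identityˡ _) (go n (h ∘ suc))

∣tabulate∣ : ∀ {P : Pred ℕ 0ℓ} (P? : Decidable P) n →
  ∣ tabulate {n = n} (λ i → does (P? (toℕ i))) ∣ ≡ length (filter P? (upTo n))
∣tabulate∣ P? n = go n id
  where
  go : ∀ n (h : ℕ → ℕ) →
    ∣ tabulate {n = n} (λ i → does (P? (h (toℕ i)))) ∣ ≡ length (filter P? (applyUpTo h n))
  go zero    h = refl
  go (suc n) h with does (P? (h 0))
  ... | true  = cong suc (go n (h ∘ suc))
  ... | false = go n (h ∘ suc)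

-- `P` stands for the set of periods of one point. The three closure properties make it the
-- multiples of its least positive member, when there is one.
module MöbiusInversion {P : Pred ℕ 0ℓ} (P? : Decidable P)
  (P-zero : P 0)
  (P-+ : ∀ i j → P i → P j → P (i + j))
  (P-∸ : ∀ i j → P i → P (i + j) → P j)
  where

  open IsSmallestPositive

  P-* : ∀ i {j} → P j → P (i * j)
  P-* zero    Pj = P-zero
  P-* (suc i) Pj = P-+ _ (i * _) Pj (P-* i Pj)

  P-∣ : ∀ {i j} → i ∣ j → P i → P j
  P-∣ (divides c refl) = P-* c

  -- Descent: either some smaller positive number satisfies `P`, or `k` itself is the least.
  order : ∀ k → 0 < k → P k → ∃ (IsSmallestPositive P)
  order = <-rec _ λ k rec k>0 Pk → search k rec k>0 Pk
    where
    search : ∀ k → (∀ {j} → j < k → 0 < j → P j → ∃ (IsSmallestPositive P)) →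
      0 < k → P k → ∃ (IsSmallestPositive P)
    search k rec k>0 Pk with anyUpTo? (λ j → 0 <? j ×-dec P? j) k
    ... | yes (j , j<k , j>0 , Pj) = rec j<k j>0 Pj
    ... | no ∄j = k , record
      { positive = k>0
      ; holds    = Pk
      ; minimal  = λ j j>0 Pj → ≮⇒≥ (λ j<k → ∄j (j , j<k , j>0 , Pj))
      }

  -- By `P-∸` the remainder of `d` modulo `o` again satisfies `P`; being below `o`, it must vanish
  -- by minimality.
  order-∣ : ∀ {o d} → IsSmallestPositive P o → P d → o ∣ d
  order-∣ {o} {d} s Pd with d % o in eq
    where instance _ = >-nonZero (positive s)
  ... | zero  = m%n≡0⇒n∣m d o eq
    where instance _ = >-nonZero (positive s)
  ... | suc r = contradiction (minimal s (suc r) z<s P[1+r]) (<⇒≱ (subst (_< o) eq (m%n<n d o)))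
    where
    instance _ = >-nonZero (positive s)
    P[1+r] : P (suc r)
    P[1+r] = P-∸ (d / o * o) (suc r) (P-* (d / o) (holds s))
      (subst P (≡.trans (m≡m%n+[m/n]*n d o)
        (≡.trans (cong (_+ d / o * o) eq) (+-comm (suc r) (d / o * o)))) Pd)

  -- The divisors of `q * o` satisfying `P` are the multiples of `o` among them, and taking
  -- complements in `q * o` sends these bijectively to the divisors of `q`. The sum is then that of
  -- `μ` over the divisors of `q`, which detects `q ≡ 1`.
  ∑-μ-multiple-order : ∀ {o} k → 0 < k → IsSmallestPositive P o → o ∣ k →
    ∑ (filter P? (divisors k)) (λ d → μ (k ÷ d)) ≡ ⟦ isSmallestPositive? P? k ⟧
  ∑-μ-multiple-order {o} .(q * o) k>0 o-order (divides q refl) = begin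
    ∑ ds (λ d → μ (q * o ÷ d))      ≡⟨ ∑-map (q * o ÷_) μ ds ⟨
    ∑ (map (q * o ÷_) ds) μ         ≡⟨ ∑-↭ complement ⟩
    ∑ (divisors q) μ                ≡⟨ ∑-μ-divisors q q>0 ⟩
    ⟦ q ≟ 1 ⟧                       ≡⟨ ⟦⟧-⇔ (q ≟ 1) (isSmallestPositive? P? (q * o)) q≡1⇒ ⇒q≡1 ⟩
    ⟦ isSmallestPositive? P? (q * o) ⟧ ∎
    where
    ds : List ℕ
    ds = filter P? (divisors (q * o))
    o>0 : 0 < o
    o>0 = positive o-order
    instance
      o≢0 : NonZero o
      o≢0 = >-nonZero o>0
    q>0 : 0 < q
    q>0 = ∣⇒>0 k>0 (m∣m*n o)
    q≡1⇒ : q ≡ 1 → IsSmallestPositive P (q * o)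
    q≡1⇒ refl = subst (IsSmallestPositive P) (sym (*-identityˡ o)) o-order
    ⇒q≡1 : IsSmallestPositive P (q * o) → q ≡ 1
    ⇒q≡1 s = ≤-antisym
      (*-cancelʳ-≤ q 1 o (subst (q * o ≤_) (sym (*-identityˡ o)) (minimal s o o>0 (holds o-order))))
      q>0
    ∈-ds : ∀ {d} → d ∈ ds → (d ∣ q * o) × P d
    ∈-ds d∈ with d∈divs , Pd ← ∈-filter⁻ P? {xs = divisors (q * o)} d∈ = ∈-divisors⁻ d∈divs , Pd
    injective : ∀ {c d} → c ∈ ds → d ∈ ds → q * o ÷ c ≡ q * o ÷ d → c ≡ d
    injective {c} {d} c∈ d∈ eq with c∣k , _ ← ∈-ds c∈ | d∣k , _ ← ∈-ds d∈ =
      *-cancelˡ-≡ c d (q * o ÷ c) {{>-nonZero (∣⇒>0 k>0 quotient-∣-k)}} (begin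
        (q * o ÷ c) * c  ≡⟨ ÷-* (∣⇒>0 k>0 c∣k) c∣k ⟩
        q * o            ≡⟨ ÷-* (∣⇒>0 k>0 d∣k) d∣k ⟨
        (q * o ÷ d) * d  ≡⟨ cong (_* d) eq ⟨
        (q * o ÷ c) * d  ∎)
      where
      quotient-∣-k : q * o ÷ c ∣ q * o
      quotient-∣-k = subst (q * o ÷ c ∣_) (÷-* (∣⇒>0 k>0 c∣k) c∣k) (m∣m*n c)
    into : ∀ {d} → d ∈ ds → q * o ÷ d ∈ divisors q
    into {d} d∈ with d∣k , Pd ← ∈-ds d∈ with divides c refl ← order-∣ o-order Pd =
      ∈-divisors⁺ q>0 (divides c (*-cancelʳ-≡ q (c * (q * o ÷ (c * o))) o (begin
        q * o                              ≡⟨ ÷-* (∣⇒>0 k>0 d∣k) d∣k ⟨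
        (q * o ÷ (c * o)) * (c * o)        ≡⟨ regroup (q * o ÷ (c * o)) c o ⟩
        c * (q * o ÷ (c * o)) * o          ∎)))
      where
      regroup : ∀ x y z → x * (y * z) ≡ y * x * z
      regroup = ℕ-Solver.solve-∀
    onto : ∀ {c} → c ∈ divisors q → ∃ λ d → d ∈ ds × c ≡ q * o ÷ d
    onto {c} c∈ with divides t q≡tc ← ∈-divisors⁻ {n = q} c∈ =
      -- With `q ≡ t * c`, the complement of `c` in `q * o` is `t * o`.
      t * o
      , ∈-filter⁺ P? (∈-divisors⁺ k>0 (divides c k≡c*d)) (P-* t (holds o-order))
      , ≡.trans (sym (*-÷ c (∣⇒>0 k>0 (divides c k≡c*d)))) (cong (_÷ (t * o)) (sym k≡c*d))
      where
      regroup : ∀ x y z → x * y * z ≡ y * (x * z)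
      regroup = ℕ-Solver.solve-∀
      k≡c*d : q * o ≡ c * (t * o)
      k≡c*d = ≡.trans (cong (_* o) q≡tc) (regroup t c o)
    complement : map (q * o ÷_) ds ↭ divisors q
    complement = map-↭
      (Unique.filter⁺ P? (divisors-unique (q * o))) (divisors-unique q) injective into onto

  -- If `P k` fails there may be no order at all, but then both sides vanish: a divisor of `k`
  -- satisfying `P` would force `P k`.
  ∑-μ-order : ∀ k → 0 < k →
    ∑ (filter P? (divisors k)) (λ d → μ (k ÷ d)) ≡ ⟦ isSmallestPositive? P? k ⟧
  ∑-μ-order k k>0 = [ periodic , aperiodic ]′ (toSum (P? k))
    where
    aperiodic : ¬ P k → _
    aperiodic ¬Pk = ≡.trans
      (∑-zero (filter P? (divisors k)) λ d∈ →
        let d∈divs , Pd = ∈-filter⁻ P? {xs = divisors k} d∈ in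
        contradiction (P-∣ (∈-divisors⁻ d∈divs) Pd) ¬Pk)
      (cong (if_then 1ℤ else 0ℤ) (sym (dec-false (isSmallestPositive? P? k) (¬Pk ∘ holds))))
    periodic : P k → _
    periodic Pk with o , o-order ← order k k>0 Pk
      = ∑-μ-multiple-order k k>0 o-order (order-∣ o-order Pk)

-- Congruences as equalities of remainders

module _ (n : ℕ) .{{_ : NonZero n}} where

  %≡⇒∣ : ∀ a b → a % n ≡ b % n → a ≡ b [mod n ]
  %≡⇒∣ a b a≡b = divides ∣ a / n - b / n ∣ (begin
    ∣ a - b ∣                                    ≡⟨ cong₂ ∣_-_∣ (m≡m%n+[m/n]*n a n) (m≡m%n+[m/n]*n b n) ⟩
    ∣ a % n + a / n * n - b % n + b / n * n ∣    ≡⟨ cong (λ r → ∣ a % n + a / n * n - r + b / n * n ∣) a≡b ⟨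
    ∣ a % n + a / n * n - a % n + b / n * n ∣    ≡⟨ ∣m+n-m+o∣≡∣n-o∣ (a % n) (a / n * n) (b / n * n) ⟩
    ∣ a / n * n - b / n * n ∣                    ≡⟨ *-distribʳ-∣-∣ n (a / n) (b / n) ⟨
    ∣ a / n - b / n ∣ * n                        ∎)

  ∣⇒%≡ : ∀ a b → a ≡ b [mod n ] → a % n ≡ b % n
  ∣⇒%≡ a b n∣ with ≤-total a b
  ... | inj₁ a≤b = ≤-case a≤b n∣
    where
    ≤-case : ∀ {a b} → a ≤ b → a ≡ b [mod n ] → a % n ≡ b % n
    ≤-case {a} {b} a≤b n∣ = ≡.trans
      (sym (%-remove-+ʳ a (subst (n ∣_) (m≤n⇒∣m-n∣≡n∸m a≤b) n∣)))
      (cong (_% n) (m+[n∸m]≡n a≤b))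
  ... | inj₂ b≤a = ≡.trans
    (cong (_% n) (sym (m+[n∸m]≡n b≤a)))
    (%-remove-+ʳ b (subst (n ∣_) (m≤n⇒∣n-m∣≡n∸m b≤a) n∣))

  *-cong-% : ∀ a b c d → a % n ≡ b % n → c % n ≡ d % n → (a * c) % n ≡ (b * d) % n
  *-cong-% a b c d a≡b c≡d = begin
    (a * c) % n              ≡⟨ %-distribˡ-* a c n ⟩
    ((a % n) * (c % n)) % n  ≡⟨ cong₂ (λ x y → (x * y) % n) a≡b c≡d ⟩
    ((b % n) * (d % n)) % n  ≡⟨ %-distribˡ-* b d n ⟨
    (b * d) % n              ∎

  +-cong-% : ∀ a b c d → a % n ≡ b % n → c % n ≡ d % n → (a + c) % n ≡ (b + d) % n
  +-cong-% a b c d a≡b c≡d = begin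
    (a + c) % n              ≡⟨ %-distribˡ-+ a c n ⟩
    ((a % n) + (c % n)) % n  ≡⟨ cong₂ (λ x y → (x + y) % n) a≡b c≡d ⟩
    ((b % n) + (d % n)) % n  ≡⟨ %-distribˡ-+ b d n ⟨
    (b + d) % n              ∎

  ^-cong-% : ∀ a b k → a % n ≡ b % n → (a ^ k) % n ≡ (b ^ k) % n
  ^-cong-% a b zero    a≡b = refl
  ^-cong-% a b (suc k) a≡b = *-cong-% a b (a ^ k) (b ^ k) a≡b (^-cong-% a b k a≡b)

-- Fermat's little theorem, from the binomial theorem

prime∤! : ∀ {p k} → Prime p → k < p → ¬ p ∣ k !
prime∤! {k = zero}  p-prime k<p p∣1 = contradiction (subst Prime (∣1⇒≡1 p∣1) p-prime) ¬prime[1]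
prime∤! {k = suc k} p-prime k<p p∣[1+k]! with euclidsLemma (suc k) (k !) p-prime p∣[1+k]!
... | inj₁ p∣1+k = >⇒∤ k<p p∣1+k
... | inj₂ p∣k!  = prime∤! p-prime (<-trans (n<1+n k) k<p) p∣k!

-- `p` divides `p !`, the product of the binomial coefficient with `k !` and `(p ∸ k) !`; the two
-- factorials have only factors below `p`.
prime∣C : ∀ {p k} → Prime p → 0 < k → k < p → p ∣ p C k
prime∣C {p@(suc p-1)} {k} p-prime k>0 k<p
  with euclidsLemma (p C k) (k ! * (p ∸ k) !) p-prime (subst (p ∣_) (sym factorial) (m∣m*n (p-1 !)))
  where
  instance _ = k !* (p ∸ k) !≢0
  factorial : (p C k) * (k ! * (p ∸ k) !) ≡ p !
  factorial = ≡.trans (cong (_* (k ! * (p ∸ k) !)) (nCk≡n!/k![n-k]! (<⇒≤ k<p)))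
    (m/n*n≡m (k![n∸k]!∣n! (<⇒≤ k<p)))
... | inj₁ p∣C = p∣C
... | inj₂ p∣!! with euclidsLemma (k !) ((p ∸ k) !) p-prime p∣!!
...   | inj₁ p∣k!    = contradiction p∣k! (prime∤! p-prime k<p)
...   | inj₂ p∣p∸k! = contradiction p∣p∸k! (prime∤! p-prime (∸-monoʳ-< k>0 (<⇒≤ k<p)))

module _ where
  open import Algebra.Bundles using (CommutativeSemiring)
  open CommutativeSemiring +-*-commutativeSemiring using (semiring)
  open import Algebra.Properties.CommutativeSemiring.Binomial +-*-commutativeSemiring
    using (binomialTerm; theorem)
  open import Algebra.Properties.Semiring.Exp semiring using () renaming (_^_ to _^ₛ_)
  open import Algebra.Properties.Semiring.Mult semiring using () renaming (_×_ to _×ₛ_)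
  open import Algebra.Properties.Semiring.Sum semiring using (sum; sum-init-last)

  ^ₛ≡^ : ∀ x n → x ^ₛ n ≡ x ^ n
  ^ₛ≡^ x zero    = refl
  ^ₛ≡^ x (suc n) = cong (x *_) (^ₛ≡^ x n)

  ×ₛ≡* : ∀ n x → n ×ₛ x ≡ n * x
  ×ₛ≡* zero    x = refl
  ×ₛ≡* (suc n) x = cong (λ y → x + y) (×ₛ≡* n x)

  ∣-sum : ∀ {d n} (t : Fin n → ℕ) → (∀ i → d ∣ t i) → d ∣ sum t
  ∣-sum {n = zero}  t d∣t = _ ∣0
  ∣-sum {n = suc n} t d∣t = ∣m∣n⇒∣m+n (d∣t zero) (∣-sum (t ∘ suc) (d∣t ∘ suc))

  freshman : ∀ {p} (p-prime : Prime p) x → let instance _ = prime⇒nonZero p-prime in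
    (suc x ^ p) % p ≡ (suc (x ^ p)) % p
  freshman {p@(suc p-1)} p-prime x = begin
    (suc x ^ p) % p                               ≡⟨ cong (_% p) (^ₛ≡^ (suc x) p) ⟨
    (suc x ^ₛ p) % p                              ≡⟨ cong (_% p) (theorem p 1 x) ⟩
    (t zero + sum (t ∘ suc)) % p                  ≡⟨ cong (λ s → (t zero + s) % p) (sum-init-last (t ∘ suc)) ⟩
    (t zero + (sum middle + t (fromℕ p))) % p     ≡⟨ cong₂ (λ a b → (a + (sum middle + b)) % p) first last ⟩
    (x ^ p + (sum middle + 1)) % p                ≡⟨ cong (_% p) (regroup (x ^ p) (sum middle)) ⟩
    (sum middle + suc (x ^ p)) % p                ≡⟨ %-remove-+ˡ (suc (x ^ p)) (∣-sum middle p∣middle) ⟩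
    suc (x ^ p) % p                               ∎
    where
    t : Fin (suc p) → ℕ
    -- The index is the exponent of 1, so the first term is `x ^ p` and the last is 1; `p` divides
    -- every term between them.
    t = binomialTerm 1 x p
    middle : Fin p-1 → ℕ
    middle i = t (suc (inject₁ i))
    regroup : ∀ a b → a + (b + 1) ≡ b + (1 + a)
    regroup = ℕ-Solver.solve-∀
    first : t zero ≡ x ^ p
    first = begin
      (p C 0) ×ₛ (1 * x ^ₛ p)   ≡⟨ ×ₛ≡* (p C 0) (1 * x ^ₛ p) ⟩
      1 * (1 * x ^ₛ p)          ≡⟨ ≡.trans (*-identityˡ _) (*-identityˡ _) ⟩
      x ^ₛ p                    ≡⟨ ^ₛ≡^ x p ⟩
      x ^ p                     ∎
    last : t (fromℕ p) ≡ 1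
    last = begin
      (p C k) ×ₛ (1 ^ₛ k * x ^ₛ (p ∸ k))  ≡⟨ ×ₛ≡* (p C k) (1 ^ₛ k * x ^ₛ (p ∸ k)) ⟩
      (p C k) * (1 ^ₛ k * x ^ₛ (p ∸ k))   ≡⟨ cong (λ k → (p C k) * (1 ^ₛ k * x ^ₛ (p ∸ k))) (toℕ-fromℕ p) ⟩
      (p C p) * (1 ^ₛ p * x ^ₛ (p ∸ p))   ≡⟨ cong₂ (λ c d → c * (1 ^ₛ p * x ^ₛ d)) (nCn≡1 p) (n∸n≡0 p) ⟩
      1 * (1 ^ₛ p * 1)                    ≡⟨ ≡.trans (*-identityˡ _) (*-identityʳ _) ⟩
      1 ^ₛ p                              ≡⟨ ≡.trans (^ₛ≡^ 1 p) (^-zeroˡ p) ⟩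
      1                                   ∎
      where
      k : ℕ
      k = toℕ (fromℕ p)
    p∣middle : ∀ i → p ∣ middle i
    p∣middle i = subst (p ∣_)
      (sym (×ₛ≡* (p C suc k) (1 ^ₛ suc k * x ^ₛ (p ∸ suc k))))
      (∣m⇒∣m*n _ (prime∣C p-prime z<s (s<s (subst (_< p-1) (sym (toℕ-inject₁ i)) (toℕ<n i)))))
      where
      k : ℕ
      k = toℕ (inject₁ i)

fermat : ∀ {p} (p-prime : Prime p) x → x ^ p ≡ x [mod p ]
fermat {p} p-prime x = %≡⇒∣ p (x ^ p) x (go x)
  where
  instance _ = prime⇒nonZero p-prime
  go : ∀ x → (x ^ p) % p ≡ x % p
  go zero    = cong (_% p) (0^p≡0 p)
    where
    0^p≡0 : ∀ p .{{_ : NonZero p}} → 0 ^ p ≡ 0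
    0^p≡0 (suc p) = refl
  go (suc x) = ≡.trans (freshman p-prime x) (+-cong-% p 1 1 (x ^ p) x refl (go x))

-- Exponents with the same fixed points

module _ (n x : ℕ) .{{_ : NonZero n}} where

  -- `x` need not be invertible, so `a` can be removed from an exponent only while a factor `x`
  -- remains; the outer `suc` guarantees one.
  absorb : ∀ a g i → x ^ suc a ≡ x [mod n ] → (x ^ suc (g + i * a)) % n ≡ (x ^ suc g) % n
  absorb a g zero    fix = cong (λ e → (x ^ suc e) % n) (+-identityʳ g)
  absorb a g (suc i) fix = begin
    (x ^ suc (g + (a + i * a))) % n      ≡⟨ cong (λ e → (x ^ e) % n) (regroup g a (i * a)) ⟩
    (x ^ (suc a + (g + i * a))) % n      ≡⟨ cong (_% n) (^-distribˡ-+-* x (suc a) (g + i * a)) ⟩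
    (x ^ suc a * x ^ (g + i * a)) % n    ≡⟨ *-cong-% n (x ^ suc a) x _ (x ^ (g + i * a)) (∣⇒%≡ n _ x fix) refl ⟩
    (x ^ suc (g + i * a)) % n            ≡⟨ absorb a g i fix ⟩
    (x ^ suc g) % n                      ∎
    where
    regroup : ∀ x y z → suc (x + (y + z)) ≡ suc y + (x + z)
    regroup = ℕ-Solver.solve-∀

  fixed-multiple : ∀ a i → x ^ suc a ≡ x [mod n ] → x ^ suc (i * a) ≡ x [mod n ]
  fixed-multiple a i fix = %≡⇒∣ n _ x (≡.trans (absorb a 0 i fix) (cong (_% n) (^-identityʳ x)))

  -- Bézout over ℕ reads `gcd a b + v * b ≡ u * a`, or the same with the roles exchanged. The
  -- exponent is first raised by a multiple of one period, using `absorb` backwards, and is then a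
  -- multiple of the other plus one.
  fixed-gcd : ∀ a b → x ^ suc a ≡ x [mod n ] → x ^ suc b ≡ x [mod n ] →
    x ^ suc (gcd a b) ≡ x [mod n ]
  fixed-gcd a b fix-a fix-b with Bézout.identity (gcd-GCD a b)
  ... | Bézout.+- u v eq = %≡⇒∣ n _ x (begin
    (x ^ suc (gcd a b)) % n             ≡⟨ absorb b (gcd a b) v fix-b ⟨
    (x ^ suc (gcd a b + v * b)) % n     ≡⟨ cong (λ e → (x ^ suc e) % n) eq ⟩
    (x ^ suc (u * a)) % n               ≡⟨ ∣⇒%≡ n _ x (fixed-multiple a u fix-a) ⟩
    x % n                               ∎)
  ... | Bézout.-+ u v eq = %≡⇒∣ n _ x (begin
    (x ^ suc (gcd a b)) % n             ≡⟨ absorb a (gcd a b) u fix-a ⟨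
    (x ^ suc (gcd a b + u * a)) % n     ≡⟨ cong (λ e → (x ^ suc e) % n) eq ⟩
    (x ^ suc (v * b)) % n               ≡⟨ ∣⇒%≡ n _ x (fixed-multiple b v fix-b) ⟩
    x % n                               ∎)

-- Monic polynomials over ℤ, and Lagrange's bound on their roots modulo p

-- The leading coefficient 1 is not stored, so a vector of length n stands for degree n.
eval : ∀ {n} → Vec ℤ n → ℤ → ℤ
eval []       x = 1ℤ
eval (c ∷ cs) x = c ℤ.+ x ℤ.* eval cs x

-- Synthetic division by X - r: the coefficients of the quotient are the Horner values at `r` of the
-- successive tails.
deflate : ∀ {n} → Vec ℤ (suc n) → ℤ → Vec ℤ n
deflate (c ∷ [])     r = []
deflate (c ∷ d ∷ cs) r = eval (d ∷ cs) r ∷ deflate (d ∷ cs) r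

-- The factor theorem as a difference of values, so that it serves an `r` which is a root only
-- modulo `p`.
eval-deflate : ∀ {n} (cs : Vec ℤ (suc n)) r x →
  eval cs x ℤ.- eval cs r ≡ (x ℤ.- r) ℤ.* eval (deflate cs r) x
eval-deflate (c ∷ [])     r x = linear c r x
  where
  linear : ∀ c r x → (c ℤ.+ x ℤ.* 1ℤ) ℤ.- (c ℤ.+ r ℤ.* 1ℤ) ≡ (x ℤ.- r) ℤ.* 1ℤ
  linear = ℤ-Solver.solve-∀
eval-deflate (c ∷ d ∷ cs) r x = begin
  (c ℤ.+ x ℤ.* f x) ℤ.- (c ℤ.+ r ℤ.* f r)              ≡⟨ split c x r (f x) (f r) ⟩
  (x ℤ.- r) ℤ.* f r ℤ.+ x ℤ.* (f x ℤ.- f r)            ≡⟨ cong (λ y → (x ℤ.- r) ℤ.* f r ℤ.+ x ℤ.* y) (eval-deflate (d ∷ cs) r x) ⟩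
  (x ℤ.- r) ℤ.* f r ℤ.+ x ℤ.* ((x ℤ.- r) ℤ.* h)        ≡⟨ merge x (x ℤ.- r) (f r) h ⟩
  (x ℤ.- r) ℤ.* (f r ℤ.+ x ℤ.* h)                      ∎
  where
  f : ℤ → ℤ
  f = eval (d ∷ cs)
  h : ℤ
  h = eval (deflate (d ∷ cs) r) x
  split : ∀ c x r a b →
    (c ℤ.+ x ℤ.* a) ℤ.- (c ℤ.+ r ℤ.* b) ≡ (x ℤ.- r) ℤ.* b ℤ.+ x ℤ.* (a ℤ.- b)
  split = ℤ-Solver.solve-∀
  merge : ∀ x y b h → y ℤ.* b ℤ.+ x ℤ.* (y ℤ.* h) ≡ y ℤ.* (b ℤ.+ x ℤ.* h)
  merge = ℤ-Solver.solve-∀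

ℤ-euclidsLemma : ∀ {p} i j → Prime p → + p ℤ.∣ i ℤ.* j → (+ p ℤ.∣ i) ⊎ (+ p ℤ.∣ j)
ℤ-euclidsLemma {p} i j p-prime p∣ij
  with euclidsLemma ℤ.∣ i ∣ ℤ.∣ j ∣ p-prime (subst (p ∣_) (ℤ.abs-* i j) (ℤ.∣⇒∣ᵤ p∣ij))
... | inj₁ p∣i = inj₁ (ℤ.∣ᵤ⇒∣ p∣i)
... | inj₂ p∣j = inj₂ (ℤ.∣ᵤ⇒∣ p∣j)

Root : ∀ {n} → ℕ → Vec ℤ n → ℕ → Set
Root p cs x = + p ℤ.∣ eval cs (+ x)

-- Induction on the degree. Splitting off the root `x` leaves a quotient of which every root
-- incongruent to `x` is a root, by Euclid's lemma; in degree 0 the polynomial is the constant 1,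
-- without roots.
lagrange : ∀ {p n xs} → Prime p → (cs : Vec ℤ n) →
  AllPairs (λ x y → ¬ + p ℤ.∣ + y ℤ.- + x) xs → All (Root p cs) xs → length xs ≤ n
lagrange p-prime cs [] [] = z≤n
lagrange p-prime [] (_ ∷ _) (p∣1 ∷ _) =
  contradiction (subst Prime (∣1⇒≡1 (ℤ.∣⇒∣ᵤ p∣1)) p-prime) ¬prime[1]
lagrange {p} {xs = x ∷ _} p-prime cs@(_ ∷ _) (x≢ ∷ xs≢) (x-root ∷ xs-roots) =
  s≤s (lagrange p-prime (deflate cs (+ x)) xs≢ (All.zipWith root (x≢ , xs-roots)))
  where
  root : ∀ {y} → (¬ + p ℤ.∣ + y ℤ.- + x) × Root p cs y → Root p (deflate cs (+ x)) y
  root {y} (y≢x , y-root) = [ (λ p∣y-x → contradiction p∣y-x y≢x) , id ]′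
    (ℤ-euclidsLemma _ _ p-prime (subst (+ p ℤ.∣_) (eval-deflate cs (+ x) (+ y))
      (ℤ.∣m∣n⇒∣m-n y-root x-root)))

-- With y = x^(g+1) this is 1 + y + ... + y^m, the cofactor of y - 1 in y^(m+1) - 1. Its leading
-- term is the implicit one.
geometric : ∀ m g → Vec ℤ (m * suc g)
geometric zero    g = []
geometric (suc m) g = 1ℤ ∷ (replicate g 0ℤ ++ geometric m g)

eval-replicate-++ : ∀ g {n} (cs : Vec ℤ n) x →
  eval (replicate g 0ℤ ++ cs) x ≡ x ℤ.^ g ℤ.* eval cs x
eval-replicate-++ zero    cs x = sym (ℤ.*-identityˡ _)
eval-replicate-++ (suc g) cs x = begin
  0ℤ ℤ.+ x ℤ.* eval (replicate g 0ℤ ++ cs) x  ≡⟨ ℤ.+-identityˡ _ ⟩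
  x ℤ.* eval (replicate g 0ℤ ++ cs) x         ≡⟨ cong (x ℤ.*_) (eval-replicate-++ g cs x) ⟩
  x ℤ.* (x ℤ.^ g ℤ.* eval cs x)               ≡⟨ ℤ.*-assoc x (x ℤ.^ g) (eval cs x) ⟨
  x ℤ.^ suc g ℤ.* eval cs x                   ∎

geometric-sum : ∀ m g x → let y = x ℤ.^ suc g in
  y ℤ.^ suc m ℤ.- 1ℤ ≡ (y ℤ.- 1ℤ) ℤ.* eval (geometric m g) x
geometric-sum zero    g x = base (x ℤ.^ suc g)
  where
  base : ∀ y → y ℤ.* 1ℤ ℤ.- 1ℤ ≡ (y ℤ.- 1ℤ) ℤ.* 1ℤ
  base = ℤ-Solver.solve-∀
geometric-sum (suc m) g x = begin
  y ℤ.* y ℤ.^ suc m ℤ.- 1ℤ                             ≡⟨ split y (y ℤ.^ suc m) ⟩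
  (y ℤ.- 1ℤ) ℤ.+ y ℤ.* (y ℤ.^ suc m ℤ.- 1ℤ)            ≡⟨ cong (λ z → (y ℤ.- 1ℤ) ℤ.+ y ℤ.* z) (geometric-sum m g x) ⟩
  (y ℤ.- 1ℤ) ℤ.+ y ℤ.* ((y ℤ.- 1ℤ) ℤ.* Q)              ≡⟨ merge x (x ℤ.^ g) Q ⟩
  (y ℤ.- 1ℤ) ℤ.* (1ℤ ℤ.+ x ℤ.* (x ℤ.^ g ℤ.* Q))        ≡⟨ cong (λ z → (y ℤ.- 1ℤ) ℤ.* (1ℤ ℤ.+ x ℤ.* z)) (eval-replicate-++ g (geometric m g) x) ⟨
  (y ℤ.- 1ℤ) ℤ.* eval (geometric (suc m) g) x          ∎
  where
  y Q : ℤ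
  y = x ℤ.^ suc g
  Q = eval (geometric m g) x
  split : ∀ y z → y ℤ.* z ℤ.- 1ℤ ≡ (y ℤ.- 1ℤ) ℤ.+ y ℤ.* (z ℤ.- 1ℤ)
  split = ℤ-Solver.solve-∀
  merge : ∀ x w q → (x ℤ.* w ℤ.- 1ℤ) ℤ.+ x ℤ.* w ℤ.* ((x ℤ.* w ℤ.- 1ℤ) ℤ.* q)
    ≡ (x ℤ.* w ℤ.- 1ℤ) ℤ.* (1ℤ ℤ.+ x ℤ.* (w ℤ.* q))
  merge = ℤ-Solver.solve-∀

-- The polynomial x^(g+2) - x. The exponent starts at 2 because x^1 - x is zero and hence not monic.
powerMinusId : ∀ g → Vec ℤ (suc (suc g))
powerMinusId g = 0ℤ ∷ -1ℤ ∷ replicate g 0ℤ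

eval-replicate : ∀ g x → eval (replicate g 0ℤ) x ≡ x ℤ.^ g
eval-replicate zero    x = refl
eval-replicate (suc g) x = ≡.trans (ℤ.+-identityˡ _) (cong (x ℤ.*_) (eval-replicate g x))

eval-powerMinusId : ∀ g x → eval (powerMinusId g) x ≡ x ℤ.^ suc (suc g) ℤ.- x
eval-powerMinusId g x = ≡.trans
  (cong (λ z → 0ℤ ℤ.+ x ℤ.* (-1ℤ ℤ.+ x ℤ.* z)) (eval-replicate g x))
  (expand x (x ℤ.^ g))
  where
  expand : ∀ x w → 0ℤ ℤ.+ x ℤ.* (-1ℤ ℤ.+ x ℤ.* w) ≡ x ℤ.* (x ℤ.* w) ℤ.- x
  expand = ℤ-Solver.solve-∀

-- The exponent on the left becomes `p` when `suc g` divides `p ∸ 1` with quotient `suc m`; the left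
-- side is then Fermat's x^p - x.
power-factorisation : ∀ m g x → x ℤ.^ suc (suc m * suc g) ℤ.- x ≡
  (x ℤ.^ suc (suc g) ℤ.- x) ℤ.* eval (geometric m g) x
power-factorisation m g x = begin
  x ℤ.* x ℤ.^ (suc m * suc g) ℤ.- x          ≡⟨ cong (λ e → x ℤ.* x ℤ.^ e ℤ.- x) (*-comm (suc m) (suc g)) ⟩
  x ℤ.* x ℤ.^ (suc g * suc m) ℤ.- x          ≡⟨ cong (λ z → x ℤ.* z ℤ.- x) (ℤ.^-*-assoc x (suc g) (suc m)) ⟨
  x ℤ.* (x ℤ.^ suc g) ℤ.^ suc m ℤ.- x        ≡⟨ pull x _ ⟩
  x ℤ.* ((x ℤ.^ suc g) ℤ.^ suc m ℤ.- 1ℤ)     ≡⟨ cong (x ℤ.*_) (geometric-sum m g x) ⟩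
  x ℤ.* ((x ℤ.^ suc g ℤ.- 1ℤ) ℤ.* Q)         ≡⟨ push x (x ℤ.^ suc g) Q ⟩
  (x ℤ.^ suc (suc g) ℤ.- x) ℤ.* Q            ∎
  where
  Q : ℤ
  Q = eval (geometric m g) x
  pull : ∀ x z → x ℤ.* z ℤ.- x ≡ x ℤ.* (z ℤ.- 1ℤ)
  pull = ℤ-Solver.solve-∀
  push : ∀ x y q → x ℤ.* ((y ℤ.- 1ℤ) ℤ.* q) ≡ (x ℤ.* y ℤ.- x) ℤ.* q
  push = ℤ-Solver.solve-∀

abs-+-+ : ∀ a b → ℤ.∣ + a ℤ.- + b ∣ ≡ ∣ a - b ∣
abs-+-+ a b = ≡.trans (cong ℤ.∣_∣ (ℤ.m-n≡m⊖n a b)) (abs-⊖ (≤-total a b))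
  where
  abs-⊖ : a ≤ b ⊎ b ≤ a → ℤ.∣ a ℤ.⊖ b ∣ ≡ ∣ a - b ∣
  abs-⊖ (inj₁ a≤b) = ≡.trans (ℤ.∣⊖∣-≤ a≤b) (sym (m≤n⇒∣m-n∣≡n∸m a≤b))
  abs-⊖ (inj₂ b≤a) = ≡.trans (ℤ.∣m⊖n∣≡∣n⊖m∣ a b) (≡.trans (ℤ.∣⊖∣-≤ b≤a) (sym (m≤n⇒∣n-m∣≡n∸m b≤a)))

pos-^ : ∀ x k → (+ x) ℤ.^ k ≡ + (x ^ k)
pos-^ x zero    = refl
pos-^ x (suc k) = ≡.trans (cong (+ x ℤ.*_) (pos-^ x k)) (sym (ℤ.pos-* x (x ^ k)))

∣-pos-^ : ∀ n s x → + n ℤ.∣ (+ x) ℤ.^ s ℤ.- + x → x ^ s ≡ x [mod n ]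
∣-pos-^ n s x n∣ = subst (n ∣_) (abs-+-+ (x ^ s) x)
  (ℤ.∣⇒∣ᵤ (subst (λ z → + n ℤ.∣ z ℤ.- + x) (pos-^ x s) n∣))

pos-^-∣ : ∀ n s x → x ^ s ≡ x [mod n ] → + n ℤ.∣ (+ x) ℤ.^ s ℤ.- + x
pos-^-∣ n s x n∣ = subst (λ z → + n ℤ.∣ z ℤ.- + x) (sym (pos-^ x s))
  (ℤ.∣ᵤ⇒∣ (subst (n ∣_) (sym (abs-+-+ (x ^ s) x)) n∣))

-- Fixed points of powering

fixed? : ∀ n s → Decidable (λ x → x ^ s ≡ x [mod n ])
fixed? n s x = n ∣? ∣ x ^ s - x ∣

fixedPoints : ℕ → ℕ → List ℕ
fixedPoints n s = filter (fixed? n s) (upTo n)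

length-filter-¬ : ∀ {A : Set} {P : Pred A 0ℓ} (P? : Decidable P) xs →
  length xs ≡ length (filter P? xs) + length (filter (¬? ∘ P?) xs)
length-filter-¬ P? []       = refl
length-filter-¬ P? (x ∷ xs) with does (P? x)
... | true  = cong suc (length-filter-¬ P? xs)
... | false = ≡.trans (cong suc (length-filter-¬ P? xs)) (sym (+-suc _ _))

%-injective-< : ∀ {n a b} → a < n → b < n → a ≡ b [mod n ] → a ≡ b
%-injective-< {n} {a} {b} a<n b<n a≡b = begin
  a      ≡⟨ m<n⇒m%n≡m a<n ⟨
  a % n  ≡⟨ ∣⇒%≡ n a b a≡b ⟩
  b % n  ≡⟨ m<n⇒m%n≡m b<n ⟩
  b      ∎
  where instance _ = >-nonZero (≤-<-trans z≤n a<n)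

upTo-incongruent : ∀ p → AllPairs (λ x y → ¬ + p ℤ.∣ + y ℤ.- + x) (upTo p)
upTo-incongruent p = AllPairs.applyUpTo⁺₁ id p λ {i} {j} i<j j<p p∣j-i →
  <⇒≢ i<j (sym (%-injective-< j<p (<-trans i<j j<p)
    (subst (p ∣_) (abs-+-+ j i) (ℤ.∣⇒∣ᵤ p∣j-i))))

-- Both x^(g+2) − x and its cofactor in x^p − x have at most as many roots as their degree,
-- and the degrees add up to p.
length-fixedPoints-divisor : ∀ {p} m g → Prime p → p ≡ suc (suc m * suc g) →
  length (fixedPoints p (suc (suc g))) ≡ suc (suc g)
length-fixedPoints-divisor {p} m g p-prime p≡ = ≤-antisym fixed≤
  -- The lower bound on `fixed` comes from the upper bound on `moved`, since the two lists together
  -- have `p` members.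
  (+-cancelʳ-≤ (m * suc g) _ _ (≤-trans (≤-reflexive total) (+-monoʳ-≤ (length fixed) moved≤)))
  where
  s : ℕ
  s = suc (suc g)
  fixed moved : List ℕ
  fixed = fixedPoints p s
  moved = filter (¬? ∘ fixed? p s) (upTo p)
  fixed≤ : length fixed ≤ suc (suc g)
  fixed≤ = lagrange p-prime (powerMinusId g)
    (AllPairs.filter⁺ (fixed? p s) (upTo-incongruent p))
    (All.map (λ {x} fix → subst (+ p ℤ.∣_) (sym (eval-powerMinusId g (+ x))) (pos-^-∣ p s x fix))
      (All.all-filter (fixed? p s) (upTo p)))
  moved≤ : length moved ≤ m * suc g
  moved≤ = lagrange p-prime (geometric m g)
    (AllPairs.filter⁺ (¬? ∘ fixed? p s) (upTo-incongruent p))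
    -- By Fermat `p` divides x^p - x; for `x` not fixed it does not divide the first factor, so it
    -- divides the cofactor.
    (All.map (λ {x} ¬fix →
        [ (λ p∣ → contradiction (∣-pos-^ p s x p∣) ¬fix) , id ]′
          (ℤ-euclidsLemma ((+ x) ℤ.^ s ℤ.- + x) _ p-prime (subst (+ p ℤ.∣_) (power-factorisation m g (+ x))
            (pos-^-∣ p (suc (suc m * suc g)) x (subst (λ t → x ^ t ≡ x [mod p ]) p≡ (fermat p-prime x))))))
      (All.all-filter (¬? ∘ fixed? p s) (upTo p)))
  total : suc (suc g) + m * suc g ≡ length fixed + length moved
  total = begin
    suc (suc m * suc g)          ≡⟨ p≡ ⟨
    p                            ≡⟨ length-applyUpTo id p ⟨
    length (upTo p)              ≡⟨ length-filter-¬ (fixed? p s) (upTo p) ⟩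
    length fixed + length moved  ∎

-- Exponents `suc a` and `suc (gcd a (p ∸ 1))` have the same fixed points, and the gcd divides
-- `p ∸ 1`. The case `a ≡ 0` fits: the gcd is then `p ∸ 1` and all `p` residues are fixed.
length-fixedPoints-prime : ∀ {p} → Prime p → ∀ a →
  length (fixedPoints p (suc a)) ≡ suc (gcd a (p ∸ 1))
length-fixedPoints-prime {zero} p-prime = contradiction p-prime ¬prime[0]
length-fixedPoints-prime {suc zero} p-prime = contradiction p-prime ¬prime[1]
length-fixedPoints-prime {p@(suc p-1@(suc _))} p-prime a = ≡.trans
  (cong length (filter-≐ (fixed? p (suc a)) (fixed? p (suc (gcd a p-1))) ((λ {x} → to {x}) , (λ {x} → from {x})) (upTo p)))
  (count (gcd a p-1) (gcd[m,n]∣n a p-1))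
  where
  to : ∀ {x} → x ^ suc a ≡ x [mod p ] → x ^ suc (gcd a p-1) ≡ x [mod p ]
  to {x} fix = fixed-gcd p x a p-1 fix (fermat p-prime x)
  from : ∀ {x} → x ^ suc (gcd a p-1) ≡ x [mod p ] → x ^ suc a ≡ x [mod p ]
  from {x} fix with divides c a≡cg ← gcd[m,n]∣m a p-1 =
    subst (λ s → x ^ suc s ≡ x [mod p ]) (sym a≡cg) (fixed-multiple p x (gcd a p-1) c fix)
  count : ∀ g → g ∣ p-1 → length (fixedPoints p (suc g)) ≡ suc g
  count zero    0∣p-1               = contradiction (0∣⇒≡0 0∣p-1) λ ()
  count (suc g) (divides zero ())
  count (suc g) (divides (suc m) eq) = length-fixedPoints-divisor m g p-prime (cong suc eq)

-- The Chinese remainder theorem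

length-cartesianProduct : ∀ {A B : Set} (xs : List A) (ys : List B) →
  length (cartesianProduct xs ys) ≡ length xs * length ys
length-cartesianProduct []       ys = refl
length-cartesianProduct (x ∷ xs) ys = ≡.trans (length-++ (map (x ,_) ys))
  (cong₂ _+_ (length-map (x ,_) ys) (length-cartesianProduct xs ys))

module _ (m n : ℕ) .{{_ : NonZero m}} .{{_ : NonZero n}} (coprime : Coprime m n) where

  inverse : ∃ λ u → (u * n) % m ≡ 1 % m
  inverse with coprime-Bézout coprime
  ... | Bézout.-+ v u eq = u , ≡.trans (cong (_% m) (sym eq)) ([m+kn]%n≡m%n 1 v m)
  -- Here `1 + v * n ≡ u * m`, so the inverse of `n` is -v, written without subtraction as
  -- `pred m * v`.
  ... | Bézout.+- u v eq = pred m * v , (begin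
    (pred m * v * n) % m                      ≡⟨ [m+n]%n≡m%n (pred m * v * n) m ⟨
    (pred m * v * n + m) % m                  ≡⟨ cong (λ s → (pred m * v * n + s) % m) (suc-pred m) ⟨
    (pred m * v * n + suc (pred m)) % m       ≡⟨ cong (_% m) (factor (pred m) v n) ⟩
    (1 + pred m * (1 + v * n)) % m            ≡⟨ cong (λ s → (1 + pred m * s) % m) eq ⟩
    (1 + pred m * (u * m)) % m                ≡⟨ cong (λ s → (1 + s) % m) (*-assoc (pred m) u m) ⟨
    (1 + pred m * u * m) % m                  ≡⟨ [m+kn]%n≡m%n 1 (pred m * u) m ⟩
    1 % m                                     ∎)
    where
    factor : ∀ p v n → p * v * n + suc p ≡ 1 + p * (1 + v * n)
    factor = ℕ-Solver.solve-∀

crt : ∀ m n .{{_ : NonZero m}} .{{_ : NonZero n}} → Coprime m n → ∀ i j →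
  ∃ λ x → (x % m ≡ i % m) × (x % n ≡ j % n)
crt m n coprime i j
  with u , un≡1 ← inverse m n coprime | v , vm≡1 ← inverse n m (Coprimality.sym coprime)
  = i * (u * n) + j * (v * m)
  , (begin
      (i * (u * n) + j * (v * m)) % m   ≡⟨ %-remove-+ʳ (i * (u * n)) (∣n⇒∣m*n j (∣n⇒∣m*n v ∣-refl)) ⟩
      (i * (u * n)) % m                 ≡⟨ *-cong-% m i i (u * n) 1 refl un≡1 ⟩
      (i * 1) % m                       ≡⟨ cong (_% m) (*-identityʳ i) ⟩
      i % m                             ∎)
  , (begin
      (i * (u * n) + j * (v * m)) % n   ≡⟨ %-remove-+ˡ (j * (v * m)) (∣n⇒∣m*n i (∣n⇒∣m*n u ∣-refl)) ⟩
      (j * (v * m)) % n                 ≡⟨ *-cong-% n j j (v * m) 1 refl vm≡1 ⟩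
      (j * 1) % n                       ≡⟨ cong (_% n) (*-identityʳ j) ⟩
      j % n                             ∎)

fixed-cong : ∀ n s x y .{{_ : NonZero n}} → x % n ≡ y % n → x ^ s ≡ x [mod n ] → y ^ s ≡ y [mod n ]
fixed-cong n s x y x≡y fix = %≡⇒∣ n (y ^ s) y (begin
  (y ^ s) % n  ≡⟨ ^-cong-% n x y s x≡y ⟨
  (x ^ s) % n  ≡⟨ ∣⇒%≡ n (x ^ s) x fix ⟩
  x % n        ≡⟨ x≡y ⟩
  y % n        ∎)

length-fixedPoints-* : ∀ m n .{{_ : NonZero m}} .{{_ : NonZero n}} → Coprime m n → ∀ s →
  length (fixedPoints (m * n) s) ≡ length (fixedPoints m s) * length (fixedPoints n s)
length-fixedPoints-* m n coprime s = begin
  length (fixedPoints (m * n) s)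
    ≡⟨ length-map residues (fixedPoints (m * n) s) ⟨
  length (map residues (fixedPoints (m * n) s))
    ≡⟨ ↭-length residues-↭ ⟩
  length (cartesianProduct (fixedPoints m s) (fixedPoints n s))
    ≡⟨ length-cartesianProduct (fixedPoints m s) (fixedPoints n s) ⟩
  length (fixedPoints m s) * length (fixedPoints n s) ∎
  where
  instance
    mn≢0 : NonZero (m * n)
    mn≢0 = m*n≢0 m n

  residues : ℕ → ℕ × ℕ
  residues x = x % m , x % n

  unique : ∀ o → _
  unique o = Unique.filter⁺ (fixed? o s) (Unique.upTo⁺ o)

  ∈-fixedPoints⁻ : ∀ o {x} → x ∈ fixedPoints o s → (x < o) × (x ^ s ≡ x [mod o ])
  ∈-fixedPoints⁻ o x∈ with x∈upTo , fix ← ∈-filter⁻ (fixed? o s) {xs = upTo o} x∈ = ∈-upTo⁻ x∈upTo , fix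

  ∈-fixedPoints⁺ : ∀ o {x} → x < o → x ^ s ≡ x [mod o ] → x ∈ fixedPoints o s
  ∈-fixedPoints⁺ o x<o fix = ∈-filter⁺ (fixed? o s) (∈-upTo⁺ x<o) fix

  injective : ∀ {x y} → x ∈ fixedPoints (m * n) s → y ∈ fixedPoints (m * n) s →
    residues x ≡ residues y → x ≡ y
  injective {x} {y} x∈ y∈ eq = %-injective-<
    (proj₁ (∈-fixedPoints⁻ (m * n) x∈)) (proj₁ (∈-fixedPoints⁻ (m * n) y∈))
    (coprime-*-∣ coprime (%≡⇒∣ m x y (cong proj₁ eq)) (%≡⇒∣ n x y (cong proj₂ eq)))

  residue-∈ : ∀ o {x} .{{_ : NonZero o}} → o ∣ m * n → x ∈ fixedPoints (m * n) s →
    x % o ∈ fixedPoints o s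
  residue-∈ o {x} o∣mn x∈ = ∈-fixedPoints⁺ o (m%n<n x o)
    (fixed-cong o s x (x % o) (sym (m%n%n≡m%n x o)) (∣-trans o∣mn (proj₂ (∈-fixedPoints⁻ (m * n) x∈))))

  onto : ∀ {ij} → ij ∈ cartesianProduct (fixedPoints m s) (fixedPoints n s) →
    ∃ λ x → x ∈ fixedPoints (m * n) s × ij ≡ residues x
  onto {i , j} ij∈
    with i∈ , j∈ ← ∈-cartesianProduct⁻ (fixedPoints m s) (fixedPoints n s) ij∈
    with i<m , i-fix ← ∈-fixedPoints⁻ m i∈ | j<n , j-fix ← ∈-fixedPoints⁻ n j∈
    with y , y≡i , y≡j ← crt m n coprime i j
    = x
    , ∈-fixedPoints⁺ (m * n) (m%n<n y (m * n))
        (coprime-*-∣ coprime (fixed-cong m s i x (sym x≡i) i-fix) (fixed-cong n s j x (sym x≡j) j-fix))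
    , cong₂ _,_ (≡.trans (sym (m<n⇒m%n≡m i<m)) (sym x≡i)) (≡.trans (sym (m<n⇒m%n≡m j<n)) (sym x≡j))
    where
    x : ℕ
    x = y % (m * n)
    x≡i : x % m ≡ i % m
    x≡i = ≡.trans (m∣n⇒o%n%m≡o%m m (m * n) y (m∣m*n n)) y≡i
    x≡j : x % n ≡ j % n
    x≡j = ≡.trans (m∣n⇒o%n%m≡o%m n (m * n) y (n∣m*n m)) y≡j

  residues-↭ : map residues (fixedPoints (m * n) s) ↭
    cartesianProduct (fixedPoints m s) (fixedPoints n s)
  residues-↭ = map-↭ (unique (m * n)) (Unique.cartesianProduct⁺ (unique m) (unique n)) injective
    (λ x∈ → ∈-cartesianProduct⁺ (residue-∈ m (m∣m*n n) x∈) (residue-∈ n (n∣m*n m) x∈))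
    onto

-- Iterating x ↦ x^e

module Iteration (n e x : ℕ) .{{_ : NonZero n}} where

  Periodic : ℕ → Set
  Periodic j = x ^ (e ^ j) ≡ x [mod n ]

  iterate : ∀ i j → Periodic i → (x ^ (e ^ (i + j))) % n ≡ (x ^ (e ^ j)) % n
  iterate i j fix = begin
    (x ^ (e ^ (i + j))) % n       ≡⟨ cong (λ s → (x ^ s) % n) (^-distribˡ-+-* e i j) ⟩
    (x ^ (e ^ i * e ^ j)) % n     ≡⟨ cong (_% n) (^-*-assoc x (e ^ i) (e ^ j)) ⟨
    ((x ^ (e ^ i)) ^ (e ^ j)) % n ≡⟨ ^-cong-% n (x ^ (e ^ i)) x (e ^ j) (∣⇒%≡ n _ x fix) ⟩
    (x ^ (e ^ j)) % n             ∎

  periodic? : Decidable Periodic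
  periodic? j = fixed? n (e ^ j) x

  periodic-zero : Periodic 0
  periodic-zero = %≡⇒∣ n _ x (cong (_% n) (^-identityʳ x))

  periodic-+ : ∀ i j → Periodic i → Periodic j → Periodic (i + j)
  periodic-+ i j fix-i fix-j = %≡⇒∣ n _ x (≡.trans (iterate i j fix-i) (∣⇒%≡ n _ x fix-j))

  periodic-∸ : ∀ i j → Periodic i → Periodic (i + j) → Periodic j
  periodic-∸ i j fix-i fix-i+j =
    %≡⇒∣ n _ x (≡.trans (sym (iterate i j fix-i)) (∣⇒%≡ n _ x fix-i+j))

theorem2 : (p q e k : ℕ) → Prime p → Prime q → p ≢ q →
    e > 0 → gcd e (φ (p * q)) ≡ 1 → k > 0 →
    + ∣ E (p * q) e k ∣ ≡
    divisorSum k (λ d → μ (k / d) ℤ.* + ((gcd (e ^ d ∸ 1) (p ∸ 1) + 1) * (gcd (e ^ d ∸ 1) (q ∸ 1) + 1)))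
theorem2 p q e k p-prime q-prime p≢q e>0 _ k>0 = begin
  + ∣ E n e k ∣
    ≡⟨ cong +_ (∣tabulate∣ order-k? n) ⟩
  + length (filter order-k? (upTo n))
    ≡⟨ length-filter-∑ order-k? (upTo n) ⟩
  ∑ (upTo n) (λ x → ⟦ order-k? x ⟧)
    -- The indicator of order `k` is replaced, point by point, by its Möbius sum.
    ≡⟨ ∑-cong (upTo n) (λ {x} _ → inversion x) ⟨
  ∑ (upTo n) (λ x → ∑ (divisors k) (λ d → ⟦ fixed? n (e ^ d) x ⟧ ℤ.* μ (k ÷ d)))
    ≡⟨ ∑-swap (λ x d → ⟦ fixed? n (e ^ d) x ⟧ ℤ.* μ (k ÷ d)) (upTo n) (divisors k) ⟩
  ∑ (divisors k) (λ d → ∑ (upTo n) (λ x → ⟦ fixed? n (e ^ d) x ⟧ ℤ.* μ (k ÷ d)))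
    ≡⟨ ∑-cong (divisors k) (λ {d} _ → count d) ⟩
  ∑ (divisors k) (λ d → μ (k ÷ d) ℤ.* + solutions d)
    -- `divisorSum` evaluates its summand at successors only, where `k ÷ d` and `k / d` agree by
    -- definition.
    ≡⟨ divisorSum-∑ k (λ d → μ (k ÷ d) ℤ.* + solutions d) ⟨
  divisorSum k (λ d → μ (k / d) ℤ.* + solutions d) ∎
  where
  n : ℕ
  n = p * q
  instance
    p≢0 : NonZero p
    p≢0 = prime⇒nonZero p-prime
    q≢0 : NonZero q
    q≢0 = prime⇒nonZero q-prime
    n≢0 : NonZero n
    n≢0 = m*n≢0 p q

  order-k? : Decidable (λ x → IsSmallestPositive (Iteration.Periodic n e x) k)
  order-k? x = isSmallestPositive? (Iteration.periodic? n e x) k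

  solutions : ℕ → ℕ
  solutions d = (gcd (e ^ d ∸ 1) (p ∸ 1) + 1) * (gcd (e ^ d ∸ 1) (q ∸ 1) + 1)

  inversion : ∀ x →
    ∑ (divisors k) (λ d → ⟦ fixed? n (e ^ d) x ⟧ ℤ.* μ (k ÷ d)) ≡ ⟦ order-k? x ⟧
  inversion x = ≡.trans
    (sym (∑-filter periodic? (λ d → μ (k ÷ d)) (divisors k)))
    (MöbiusInversion.∑-μ-order periodic? periodic-zero periodic-+ periodic-∸ k k>0)
    where open Iteration n e x

  length-fixedPoints : ∀ {r} → Prime r → ∀ d →
    length (fixedPoints r (e ^ d)) ≡ gcd (e ^ d ∸ 1) (r ∸ 1) + 1
  length-fixedPoints {r} r-prime d = begin
    -- The truncated `e ^ d ∸ 1` is a true predecessor because `e ^ d` is positive.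
    length (fixedPoints r (e ^ d))            ≡⟨ cong (λ s → length (fixedPoints r s)) (m+[n∸m]≡n (m^n>0 e d)) ⟨
    length (fixedPoints r (suc (e ^ d ∸ 1)))  ≡⟨ length-fixedPoints-prime r-prime (e ^ d ∸ 1) ⟩
    suc (gcd (e ^ d ∸ 1) (r ∸ 1))             ≡⟨ +-comm 1 _ ⟩
    gcd (e ^ d ∸ 1) (r ∸ 1) + 1               ∎
    where instance _ = >-nonZero e>0

  count : ∀ d →
    ∑ (upTo n) (λ x → ⟦ fixed? n (e ^ d) x ⟧ ℤ.* μ (k ÷ d)) ≡ μ (k ÷ d) ℤ.* + solutions d
  count d = begin
    ∑ (upTo n) (λ x → ⟦ fixed? n (e ^ d) x ⟧ ℤ.* μ (k ÷ d))
      ≡⟨ ∑-cong (upTo n) (λ {x} _ → ℤ.*-comm ⟦ fixed? n (e ^ d) x ⟧ (μ (k ÷ d))) ⟩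
    ∑ (upTo n) (λ x → μ (k ÷ d) ℤ.* ⟦ fixed? n (e ^ d) x ⟧)
      ≡⟨ ∑-*ˡ (μ (k ÷ d)) (λ x → ⟦ fixed? n (e ^ d) x ⟧) (upTo n) ⟩
    μ (k ÷ d) ℤ.* ∑ (upTo n) (λ x → ⟦ fixed? n (e ^ d) x ⟧)
      ≡⟨ cong (μ (k ÷ d) ℤ.*_) (length-filter-∑ (fixed? n (e ^ d)) (upTo n)) ⟨
    μ (k ÷ d) ℤ.* + length (fixedPoints n (e ^ d))
      ≡⟨ cong (λ c → μ (k ÷ d) ℤ.* + c)
           (length-fixedPoints-* p q (primes-coprime p-prime q-prime p≢q) (e ^ d)) ⟩
    μ (k ÷ d) ℤ.* + (length (fixedPoints p (e ^ d)) * length (fixedPoints q (e ^ d)))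
      ≡⟨ cong₂ (λ a b → μ (k ÷ d) ℤ.* + (a * b))
           (length-fixedPoints p-prime d) (length-fixedPoints q-prime d) ⟩
    μ (k ÷ d) ℤ.* + solutions d ∎
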